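{- Let $(G_1,G_2,G_3)$ be an additive triple of DAGs with $G_i = (V,E_i)$. Then there is a 3-layered DAG $G^* = (V^* = V_1^* \cup V_2^* \cup V_3^*, E^*, w)$ with positive edge weights and $|V_2^*| = 3$ such that: (1) $|V_1^*| = |V|$; (2) $|V_3^*| = |E_1| + |E_2| + |E_3|$; (3) $$\inf_{(h_1',h_2',h_3')} \mathrm{range}(h_1',h_2',h_3') \;\le\; 2 \cdot \inf_{G' = (V^*, E^*,w')} \Big(\max_{e \in E^*} w'(e)\Big),$$ where the first infimum is over all 3-topological order preservers $(h_1',h_2',h_3')$ of $(G_1,G_2,G_3)$ and the second is over all gap-1 shortest-paths preservers $G' = (V^*, E^*, w')$ of $G^*$.
   Context: Graphs are finite and vertex sets nonempty. For a DAG $G=(V,E)$, a topological ordering is a function $h:V\to\mathbb R$ with $h(u)+1\le h(v)$ for all $(u,v)\in E$. A triple $(G_1,G_2,G_3)$ of DAGs $G_i=(V,E_i)$ on the same vertex set is an additive triple if there exist topological orderings $h_i$ of $G_i$ ($i=1,2,3$) with $h_1(v)+h_2(v)=h_3(v)$ for all $v\in V$; any such $(h_1,h_2,h_3)$ is called a 3-topological order preserver of $(G_1,G_2,G_3)$. Its range is $\mathrm{range}(h_1,h_2,h_3):=\max_{i\in\{1,2,3\}}\left(\max_{v\in V}h_i(v)-\min_{v\in V}h_i(v)\right)$. A 3-layered DAG is a directed graph whose vertex set is a disjoint union $V_1^* \cup V_2^* \cup V_3^*$ and all of whose edges go from $V_1^*$ to $V_2^*$ or from $V_2^*$ to $V_3^*$.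 The weight of a path is the sum of its edge weights; a shortest path is a directed path of minimum weight between its endpoints. Given $G^*=(V^*,E^*,w)$, a graph $G'=(V^*,E^*,w')$ with positive real edge weights $w'$ is a gap-1 shortest-paths preserver of $G^*$ if (i) every shortest path in $G'$ is (as a sequence of vertices and edges) a shortest path in $G^*$, and (ii) for any shortest path $\pi$ in $G'$ and any path $\pi'$ with the same endpoints that is not a shortest path in $G'$, $w'(\pi)+1\le w'(\pi')$. -}

module Defs where

open import Data.Nat.Base using (ℕ; zero; suc)
open import Data.Rational.Base using (ℚ; 0ℚ; 1ℚ; ½)
import Data.Rational.Base as ℚ
import Data.Rational.Properties as ℚ
open import Data.Rational.Solver using (module +-*-Solver)
open import Data.Fin.Base using (Fin; zero; suc)
open import Data.Product.Base using (_×_; _,_; ∃-syntax; proj₁; proj₂)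
open import Data.Sum.Base using (_⊎_; inj₁; inj₂)
open import Function.Definitions using (Injective)
open import Relation.Binary.PropositionalEquality
  using (_≡_; refl; sym; subst)
open import Relation.Nullary.Negation using (¬_)

------------------------------------------------------------------------
-- Real numbers, as regular Cauchy sequences of rationals: the n-th term
-- is within 1/2ⁿ of the number represented.

½^_ : ℕ → ℚ
½^ zero  = 1ℚ
½^ suc n = ½ ℚ.* (½^ n)

-- One-sided; exchanging m and n gives |xₘ - xₙ| ≤ 1/2ᵐ + 1/2ⁿ.
Regular : (ℕ → ℚ) → Set
Regular x = ∀ m n → x m ℚ.≤ x n ℚ.+ ((½^ m) ℚ.+ (½^ n))

record ℝ : Set where
  constructor mkℝ
  field
    seq     : ℕ → ℚ
    regular : Regular seq

open ℝ public

0≤½^ : ∀ n → 0ℚ ℚ.≤ ½^ n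
0≤½^ zero    = ℚ.nonNegative⁻¹ 1ℚ
0≤½^ (suc n) = subst (ℚ._≤ (½ ℚ.* (½^ n))) (ℚ.*-zeroʳ ½)
                 (ℚ.*-monoˡ-≤-nonNeg ½ (0≤½^ n))

p≤p+½^ : ∀ p m n → p ℚ.≤ p ℚ.+ ((½^ m) ℚ.+ (½^ n))
p≤p+½^ p m n = subst (ℚ._≤ (p ℚ.+ ((½^ m) ℚ.+ (½^ n)))) (ℚ.+-identityʳ p)
  (ℚ.+-monoʳ-≤ p (ℚ.+-mono-≤ (0≤½^ m) (0≤½^ n)))

infix  8 -_
infixl 6 _+_ _-_
infixl 5 _⊔_ _⊓_
infix  4 _≤_ _<_ _≃_

fromℚ : ℚ → ℝ
fromℚ q = mkℝ (λ _ → q) (p≤p+½^ q)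

0ℝ 1ℝ : ℝ
0ℝ = fromℚ 0ℚ
1ℝ = fromℚ 1ℚ

private
  +-regular : ∀ {x y} → Regular x → Regular y →
              Regular (λ n → x (suc n) ℚ.+ y (suc n))
  +-regular {x} {y} rx ry m n =
    subst ((x (suc m) ℚ.+ y (suc m)) ℚ.≤_)
      (solve 4 (λ a b c d →
         (a :+ (con ½ :* c :+ con ½ :* d)) :+ (b :+ (con ½ :* c :+ con ½ :* d))
         := (a :+ b) :+ (c :+ d))
       refl (x (suc n)) (y (suc n)) (½^ m) (½^ n))
      (ℚ.+-mono-≤ (rx (suc m) (suc n)) (ry (suc m) (suc n)))
    where open +-*-Solver

  neg-regular : ∀ {x} → Regular x → Regular (λ n → ℚ.- x n)
  neg-regular {x} rx m n =
    subst (ℚ._≤ ((ℚ.- x n) ℚ.+ ((½^ m) ℚ.+ (½^ n))))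
      (solve 2 (λ a b → (:- a :+ (:- b)) :+ a := :- b) refl (x n) (x m))
      (subst (((ℚ.- x n) ℚ.+ (ℚ.- x m)) ℚ.+ x n ℚ.≤_)
        (solve 4 (λ a b c d → (:- a :+ (:- b)) :+ (b :+ (d :+ c)) := :- a :+ (c :+ d))
          refl (x n) (x m) (½^ m) (½^ n))
        (ℚ.+-monoʳ-≤ ((ℚ.- x n) ℚ.+ (ℚ.- x m)) (rx n m)))
    where open +-*-Solver

  ⊔-regular : ∀ {x y} → Regular x → Regular y → Regular (λ n → x n ℚ.⊔ y n)
  ⊔-regular {x} {y} rx ry m n = ℚ.⊔-lub
    (ℚ.≤-trans (rx m n) (ℚ.+-monoˡ-≤ _ (ℚ.p≤p⊔q (x n) (y n))))
    (ℚ.≤-trans (ry m n) (ℚ.+-monoˡ-≤ _ (ℚ.p≤q⊔p (x n) (y n))))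

  ⊓-regular : ∀ {x y} → Regular x → Regular y → Regular (λ n → x n ℚ.⊓ y n)
  ⊓-regular {x} {y} rx ry m n =
    subst ((x m ℚ.⊓ y m) ℚ.≤_)
      (sym (ℚ.mono-≤-distrib-⊓ (ℚ.+-monoˡ-≤ ((½^ m) ℚ.+ (½^ n))) (x n) (y n)))
      (ℚ.⊓-mono-≤ (rx m n) (ry m n))

_+_ : ℝ → ℝ → ℝ
mkℝ x rx + mkℝ y ry = mkℝ (λ n → x (suc n) ℚ.+ y (suc n)) (+-regular {x} {y} rx ry)

-_ : ℝ → ℝ
- mkℝ x rx = mkℝ (λ n → ℚ.- x n) (neg-regular {x} rx)

_-_ : ℝ → ℝ → ℝ
x - y = x + (- y)

_⊔_ : ℝ → ℝ → ℝ
mkℝ x rx ⊔ mkℝ y ry = mkℝ (λ n → x n ℚ.⊔ y n) (⊔-regular {x} {y} rx ry)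

_⊓_ : ℝ → ℝ → ℝ
mkℝ x rx ⊓ mkℝ y ry = mkℝ (λ n → x n ℚ.⊓ y n) (⊓-regular {x} {y} rx ry)

_≤_ : ℝ → ℝ → Set
x ≤ y = ∀ n → seq x n ℚ.≤ seq y n ℚ.+ ((½^ n) ℚ.+ (½^ n))

_<_ : ℝ → ℝ → Set
x < y = ∃[ n ] (seq x n ℚ.+ ((½^ n) ℚ.+ (½^ n)) ℚ.< seq y n)

-- Equality of the numbers represented; _≡_ on ℝ is too fine.
_≃_ : ℝ → ℝ → Set
x ≃ y = x ≤ y × y ≤ x

-- By convention the maximum and minimum over an empty index set are 0.
max min : ∀ {n} → (Fin n → ℝ) → ℝ
max {zero}        f = 0ℝ
max {suc zero}    f = f zero
max {suc (suc n)} f = f zero ⊔ max (λ i → f (suc i))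

min {zero}        f = 0ℝ
min {suc zero}    f = f zero
min {suc (suc n)} f = f zero ⊓ min (λ i → f (suc i))

IsLowerBound : (ℝ → Set) → ℝ → Set
IsLowerBound P ℓ = ∀ r → P r → ℓ ≤ r

IsInfimum : (ℝ → Set) → ℝ → Set
IsInfimum P a = IsLowerBound P a × (∀ ℓ → IsLowerBound P ℓ → ℓ ≤ a)

-- inf P ≤ 2 · inf Q.  Constructively the infimum of an inhabited set that
-- is bounded below need not be available as a real number, so the
-- inequality is asserted both for the infima themselves and for the lower
-- bounds of P; classically the two clauses are equivalent as soon as P and
-- Q have infima.
Inf_≤2·Inf_ : (ℝ → Set) → (ℝ → Set) → Set
Inf P ≤2·Inf Q =
  (∀ a b → IsInfimum P a → IsInfimum Q b → a ≤ b + b) ×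
  (∀ ℓ → IsLowerBound P ℓ → ∀ r → Q r → ℓ ≤ r + r)

------------------------------------------------------------------------
-- Finite digraphs

-- E is a set of ordered pairs, enumerated without repetition by Fin ∣E∣.
record Digraph (V : Set) : Set where
  field
    ∣E∣      : ℕ
    edge     : Fin ∣E∣ → V × V
    edge-inj : Injective _≡_ _≡_ edge

  Edge : Set
  Edge = Fin ∣E∣

  src tgt : Edge → V
  src e = proj₁ (edge e)
  tgt e = proj₂ (edge e)

open Digraph public

data Path {V : Set} (G : Digraph V) : V → V → Set where
  []   : ∀ {v} → Path G v v
  step : ∀ {u v t} (e : Edge G) → edge G e ≡ (u , v) → Path G v t → Path G u t

Acyclic : ∀ {V} → Digraph V → Set
Acyclic G = ∀ e → ¬ Path G (tgt G e) (src G e)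

------------------------------------------------------------------------
-- Topological orderings and additive triples

IsTopologicalOrdering : ∀ {V} → Digraph V → (V → ℝ) → Set
IsTopologicalOrdering G h = ∀ e → h (src G e) + 1ℝ ≤ h (tgt G e)

module _ {n : ℕ} (G₁ G₂ G₃ : Digraph (Fin n)) where

  IsOrderPreserver : (h₁ h₂ h₃ : Fin n → ℝ) → Set
  IsOrderPreserver h₁ h₂ h₃ =
    IsTopologicalOrdering G₁ h₁ ×
    IsTopologicalOrdering G₂ h₂ ×
    IsTopologicalOrdering G₃ h₃ ×
    (∀ v → h₁ v + h₂ v ≃ h₃ v)

  IsAdditiveTriple : Set
  IsAdditiveTriple = ∃[ h₁ ] ∃[ h₂ ] ∃[ h₃ ] IsOrderPreserver h₁ h₂ h₃

spread : ∀ {n} → (Fin n → ℝ) → ℝ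
spread h = max h - min h

range : ∀ {n} → (h₁ h₂ h₃ : Fin n → ℝ) → ℝ
range h₁ h₂ h₃ = spread h₁ ⊔ spread h₂ ⊔ spread h₃

PreserverRange : ∀ {n} → (G₁ G₂ G₃ : Digraph (Fin n)) → ℝ → Set
PreserverRange G₁ G₂ G₃ r =
  ∃[ h₁ ] ∃[ h₂ ] ∃[ h₃ ] (IsOrderPreserver G₁ G₂ G₃ h₁ h₂ h₃ × r ≃ range h₁ h₂ h₃)

------------------------------------------------------------------------
-- Shortest paths and their preservers

module _ {V : Set} (G : Digraph V) where

  Weighting : Set
  Weighting = Edge G → ℝ

  Positive : Weighting → Set
  Positive w = ∀ e → 0ℝ < w e

  weight : Weighting → ∀ {u v} → Path G u v → ℝ
  weight w []           = 0ℝ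
  weight w (step e _ π) = w e + weight w π

  IsShortest : Weighting → ∀ {u v} → Path G u v → Set
  IsShortest w {u} {v} π = ∀ (π′ : Path G u v) → weight w π ≤ weight w π′

  record IsGap1Preserver (w w′ : Weighting) : Set where
    field
      positive : Positive w′
      preserve : ∀ {u v} (π : Path G u v) → IsShortest w′ π → IsShortest w π
      gap      : ∀ {u v} (π π′ : Path G u v) →
                 IsShortest w′ π → ¬ IsShortest w′ π′ →
                 weight w′ π + 1ℝ ≤ weight w′ π′

  PreserverMaxWeight : Weighting → ℝ → Set
  PreserverMaxWeight w r = ∃[ w′ ] (IsGap1Preserver w w′ × r ≃ max w′)

------------------------------------------------------------------------
-- 3-layered DAGs

LayeredVertex : (n₁ n₂ n₃ : ℕ) → Set
LayeredVertex n₁ n₂ n₃ = Fin n₁ ⊎ Fin n₂ ⊎ Fin n₃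

data Consecutive {n₁ n₂ n₃ : ℕ} :
     LayeredVertex n₁ n₂ n₃ × LayeredVertex n₁ n₂ n₃ → Set where
  V₁→V₂ : ∀ i j → Consecutive (inj₁ i , inj₂ (inj₁ j))
  V₂→V₃ : ∀ j k → Consecutive (inj₂ (inj₁ j) , inj₂ (inj₂ k))

record WeightedLayeredDAG : Set where
  field
    ∣V₁∣ ∣V₂∣ ∣V₃∣ : ℕ
    graph      : Digraph (LayeredVertex ∣V₁∣ ∣V₂∣ ∣V₃∣)
    layered    : ∀ e → Consecutive (edge graph e)
    w          : Weighting graph
    w-positive : Positive graph w

{-# OPTIONS --safe #-}
module Submission where

-- V₂ consists of three vertices p, q, r.  A weighting w′ of the edges V₁ → V₂
-- gives potentials f x v = w′ (v , x) on V, and the differences h₁ = f p - f q,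
-- h₂ = f q - f r, h₃ = f p - f r satisfy h₁ + h₂ = h₃.  An edge (u , v) of Gᵢ
-- becomes a vertex of V₃ reached from the two middle vertices defining hᵢ, with
-- weights such that the first of them is on the shortest path from u and the
-- second on the shortest path from v.  A gap-1 preserver w′ has to respect both
-- choices, which says precisely that hᵢ u + 1 ≤ hᵢ v.  If all weights lie
-- in [0, M], then hᵢ takes values in [-M, M].

open import Defs
open import Data.Nat.Base using (ℕ; NonZero) renaming (_+_ to _+ℕ_)
open import Data.Fin.Base using (Fin)
open import Data.Product.Base using (_×_; ∃-syntax)
open import Relation.Binary.PropositionalEquality using (_≡_)
open WeightedLayeredDAG

open import Data.Nat.Base using (zero; suc; s≤s; z≤n; ≢-nonZero⁻¹) renaming (_*_ to _*ℕ_)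
import Data.Integer.Base as ℤ
import Data.Integer.Properties as ℤ
open import Data.Rational.Base as ℚ using (ℚ; 0ℚ; 1ℚ; ½; toℚᵘ; ↥_; ↧_)
import Data.Rational.Properties as ℚ
open import Data.Rational.Solver using (module +-*-Solver)
import Data.Rational.Unnormalised.Base as ℚᵘ
import Data.Rational.Unnormalised.Properties as ℚᵘ
open import Data.Fin.Base using (zero; suc)
open import Data.Fin.Properties using (+↔⊎; *↔×)
open import Data.Product.Base using (_,_; proj₁; proj₂)
open import Data.Sum.Base using (_⊎_; inj₁; inj₂)
open import Data.Sum.Function.Propositional using (_⊎-↔_)
open import Function.Base using (_∘_)
open import Function.Bundles using (_↔_; module Inverse; module Injection)
open import Function.Properties.Inverse using (↔-refl; ↔-trans; Inverse⇒Injection)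
open import Relation.Binary.PropositionalEquality
  using (_≢_; refl; sym; cong; subst; subst₂; module ≡-Reasoning)
open import Relation.Nullary.Decidable.Core using (from-yes; from-no; yes; no)
open import Relation.Nullary.Negation using (¬_; contradiction)
open +-*-Solver using (solve; _:=_; _:+_; _:*_; _:-_; :-_; con)

-- Rational inequalities and the Archimedean property.

-- The equation says that `q - p` and `q′ - p′` agree. Being subtraction-free in form, it is a goal
-- for the ring solver, so every linear step below is one inequality and one identity.
≤-rearrange : ∀ {p q p′ q′} → p ℚ.≤ q → p′ ℚ.+ q ≡ p ℚ.+ q′ → p′ ℚ.≤ q′
≤-rearrange {p} {q} {p′} {q′} p≤q eq = subst₂ ℚ._≤_ lhs rhs
  (ℚ.+-monoʳ-≤ (p′ ℚ.- p) p≤q)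
  where
  lhs : (p′ ℚ.- p) ℚ.+ p ≡ p′
  lhs = solve 2 (λ a b → (a :- b) :+ b := a) refl p′ p
  rhs : (p′ ℚ.- p) ℚ.+ q ≡ q′
  rhs = begin
    (p′ ℚ.- p) ℚ.+ q  ≡⟨ solve 3 (λ a b c → (a :- b) :+ c := (a :+ c) :- b) refl p′ p q ⟩
    (p′ ℚ.+ q) ℚ.- p  ≡⟨ cong (ℚ._- p) eq ⟩
    (p ℚ.+ q′) ℚ.- p  ≡⟨ solve 2 (λ a b → (a :+ b) :- a := b) refl p q′ ⟩
    q′                ∎
    where open ≡-Reasoning

fromℕ : ℕ → ℚ
fromℕ zero    = 0ℚ
fromℕ (suc n) = 1ℚ ℚ.+ fromℕ n

fromℕ-nonNeg : ∀ n → 0ℚ ℚ.≤ fromℕ n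
fromℕ-nonNeg zero    = ℚ.≤-refl
fromℕ-nonNeg (suc n) = ℚ.+-mono-≤ (from-yes (0ℚ ℚ.≤? 1ℚ)) (fromℕ-nonNeg n)

toℚᵘ-fromℕ : ∀ n → toℚᵘ (fromℕ n) ℚᵘ.≃ ℚᵘ.mkℚᵘ (ℤ.+ n) 0
toℚᵘ-fromℕ zero    = ℚᵘ.≃-refl
toℚᵘ-fromℕ (suc n) = ℚᵘ.≃-trans (ℚ.toℚᵘ-homo-+ 1ℚ (fromℕ n))
  (ℚᵘ.≃-trans (ℚᵘ.+-congʳ ℚᵘ.1ℚᵘ (toℚᵘ-fromℕ n))
    (ℚᵘ.*≡* (cong (λ k → (ℤ.+ 1 ℤ.+ k) ℤ.* ℤ.+ 1) (ℤ.*-identityʳ (ℤ.+ n)))))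

i≤∣i∣ : ∀ i → i ℤ.≤ ℤ.+ ℤ.∣ i ∣
i≤∣i∣ (ℤ.+ n)      = ℤ.≤-refl
i≤∣i∣ (ℤ.-[1+ n ]) = ℤ.-≤+

-- The denominator is at least 1, so the absolute value of the numerator is already large enough.
archimedean : ∀ p → p ℚ.≤ fromℕ ℤ.∣ ↥ p ∣
archimedean p@record{} = ℚ.toℚᵘ-cancel-≤
  (ℚᵘ.≤-respʳ-≃ (ℚᵘ.≃-sym (toℚᵘ-fromℕ ℤ.∣ ↥ p ∣)) (ℚᵘ.*≤* lemma))
  where
  N = ℤ.+ ℤ.∣ ↥ p ∣
  lemma : ↥ p ℤ.* ℤ.+ 1 ℤ.≤ N ℤ.* ↧ p
  lemma = ℤ.≤-trans (ℤ.*-monoʳ-≤-nonNeg (ℤ.+ 1) (i≤∣i∣ (↥ p)))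
    (ℤ.*-monoˡ-≤-nonNeg N {ℤ.+ 1} {↧ p} (ℤ.+≤+ (s≤s z≤n)))

½^n≤1 : ∀ n → ½^ n ℚ.≤ 1ℚ
½^n≤1 zero    = ℚ.≤-refl
½^n≤1 (suc n) = ℚ.≤-trans (ℚ.*-monoˡ-≤-nonNeg ½ (½^n≤1 n)) (from-yes (½ ℚ.* 1ℚ ℚ.≤? 1ℚ))

½^n*n≤1 : ∀ n → ½^ n ℚ.* fromℕ n ℚ.≤ 1ℚ
½^n*n≤1 zero    = from-yes (1ℚ ℚ.* 0ℚ ℚ.≤? 1ℚ)
½^n*n≤1 (suc n) = subst (ℚ._≤ 1ℚ)
  (solve 2 (λ e m → con ½ :* (e :+ e :* m) := con ½ :* e :* (con 1ℚ :+ m)) refl (½^ n) (fromℕ n))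
  (ℚ.*-monoˡ-≤-nonNeg ½ (ℚ.+-mono-≤ (½^n≤1 n) (½^n*n≤1 n)))

-- If `d = a - b` were positive, choose a natural number `N` above `C ÷ d`. Since `½^ m` times `m`
-- is at most 1, the hypothesis at `m = suc N` gives `d * (N + 1) ≤ C ≤ d * N`, hence `d ≤ 0`.
≤-of-≤+½^ : ∀ {a b} C → (∀ m → a ℚ.≤ b ℚ.+ C ℚ.* ½^ m) → a ℚ.≤ b
≤-of-≤+½^ {a} {b} C a≤b+ with a ℚ.≤? b
... | yes a≤b = a≤b
... | no  a≰b = contradiction (ℚ.<-≤-trans 0<d d≤0) (ℚ.<-irrefl refl)
  where
  d = a ℚ.- b
  0<d : 0ℚ ℚ.< d
  0<d = subst (ℚ._< d) (ℚ.+-inverseʳ b) (ℚ.+-monoˡ-< (ℚ.- b) (ℚ.≰⇒> a≰b))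
  d≤C½^ : ∀ m → d ℚ.≤ C ℚ.* ½^ m
  d≤C½^ m = ≤-rearrange (a≤b+ m)
    (solve 3 (λ a b c → (a :- b) :+ (b :+ c) := a :+ c) refl a b (C ℚ.* ½^ m))
  instance
    d-pos : ℚ.Positive d
    d-pos = ℚ.positive 0<d
    d≢0 : ℚ.NonZero d
    d≢0 = ℚ.pos⇒nonZero d
    d-nonNeg : ℚ.NonNegative d
    d-nonNeg = ℚ.pos⇒nonNeg d
    -- At index 0 the bound reads `d ≤ C`, and `d` is positive.
    C-nonNeg : ℚ.NonNegative C
    C-nonNeg = ℚ.nonNegative (ℚ.≤-trans (ℚ.<⇒≤ 0<d)
      (subst (d ℚ.≤_) (ℚ.*-identityʳ C) (d≤C½^ 0)))
  N = ℤ.∣ ↥ (C ℚ.÷ d) ∣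
  M = fromℕ (suc N)
  C≤dN : C ℚ.≤ d ℚ.* fromℕ N
  C≤dN = subst (ℚ._≤ d ℚ.* fromℕ N) eq (ℚ.*-monoˡ-≤-nonNeg d (archimedean (C ℚ.÷ d)))
    where
    eq : d ℚ.* (C ℚ.* ℚ.1/ d) ≡ C
    eq = begin
      d ℚ.* (C ℚ.* ℚ.1/ d)  ≡⟨ solve 3 (λ x y z → x :* (y :* z) := y :* (x :* z)) refl d C (ℚ.1/ d) ⟩
      C ℚ.* (d ℚ.* ℚ.1/ d)  ≡⟨ cong (C ℚ.*_) (ℚ.*-inverseʳ d) ⟩
      C ℚ.* 1ℚ              ≡⟨ ℚ.*-identityʳ C ⟩
      C                     ∎
      where open ≡-Reasoning
  dM≤C : d ℚ.* M ℚ.≤ C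
  dM≤C = begin
    d ℚ.* M                       ≤⟨ ℚ.*-monoʳ-≤-nonNeg M {{ℚ.nonNegative (fromℕ-nonNeg (suc N))}} (d≤C½^ (suc N)) ⟩
    C ℚ.* (½^ (suc N)) ℚ.* M      ≡⟨ ℚ.*-assoc C (½^ (suc N)) M ⟩
    C ℚ.* ((½^ (suc N)) ℚ.* M)    ≤⟨ ℚ.*-monoˡ-≤-nonNeg C (½^n*n≤1 (suc N)) ⟩
    C ℚ.* 1ℚ                      ≡⟨ ℚ.*-identityʳ C ⟩
    C                             ∎
    where open ℚ.≤-Reasoning
  d≤0 : d ℚ.≤ 0ℚ
  d≤0 = ≤-rearrange (ℚ.≤-trans dM≤C C≤dN)
    (solve 2 (λ d n → d :+ d :* n := d :* (con 1ℚ :+ n) :+ con 0ℚ) refl d (fromℕ N))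

-- Real inequalities up to a vanishing error.

infix  4 _≲_ _≈_
infix  8 ‵_ ⊝_
infixl 6 _⊕_ _⊖_

-- An inequality up to a multiple of ½^ m: equivalent to _≤_ on the terms of real
-- numbers, and insensitive to the index shifts in the arithmetic of ℝ.
record _≲_ (s t : ℕ → ℚ) : Set where
  constructor _,_
  field
    factor : ℚ
    bound  : ∀ m → s m ℚ.≤ t m ℚ.+ factor ℚ.* ½^ m

_≈_ : (ℕ → ℚ) → (ℕ → ℚ) → Set
s ≈ t = s ≲ t × t ≲ s

≤⇒≲ : ∀ {s t} → (∀ m → s m ℚ.≤ t m) → s ≲ t
≤⇒≲ {s} {t} s≤t = 0ℚ , λ m → ≤-rearrange (s≤t m)
  (solve 3 (λ s t e → s :+ t := s :+ (t :+ con 0ℚ :* e)) refl (s m) (t m) (½^ m))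

≲-trans : ∀ {s t u} → s ≲ t → t ≲ u → s ≲ u
≲-trans {s} {t} {u} (C , s≲t) (D , t≲u) = C ℚ.+ D , λ m →
  ≤-rearrange (ℚ.+-mono-≤ (s≲t m) (t≲u m))
    (solve 6 (λ s t u C D e →
      s :+ ((t :+ C :* e) :+ (u :+ D :* e)) := (s :+ t) :+ (u :+ (C :+ D) :* e))
      refl (s m) (t m) (u m) C D (½^ m))

+-mono-≲ : ∀ {s t s′ t′} → s ≲ t → s′ ≲ t′ → (λ m → s m ℚ.+ s′ m) ≲ (λ m → t m ℚ.+ t′ m)
+-mono-≲ {s} {t} {s′} {t′} (C , s≲t) (D , s′≲t′) = C ℚ.+ D , λ m →
  ≤-rearrange (ℚ.+-mono-≤ (s≲t m) (s′≲t′ m))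
    (solve 7 (λ s t s′ t′ C D e →
      (s :+ s′) :+ ((t :+ C :* e) :+ (t′ :+ D :* e)) :=
      (s :+ s′) :+ ((t :+ t′) :+ (C :+ D) :* e))
      refl (s m) (t m) (s′ m) (t′ m) C D (½^ m))

neg-antimono-≲ : ∀ {s t} → s ≲ t → (λ m → ℚ.- t m) ≲ (λ m → ℚ.- s m)
neg-antimono-≲ {s} {t} (C , s≲t) = C , λ m → ≤-rearrange (s≲t m)
  (solve 4 (λ s t C e → :- t :+ (t :+ C :* e) := s :+ (:- s :+ C :* e))
    refl (s m) (t m) C (½^ m))

*-monoˡ-≲ : ∀ r .{{_ : ℚ.NonNegative r}} {s t} → s ≲ t → (λ m → r ℚ.* s m) ≲ (λ m → r ℚ.* t m)
*-monoˡ-≲ r {s} {t} (C , s≲t) = r ℚ.* C , λ m → ≤-rearrange (ℚ.*-monoˡ-≤-nonNeg r (s≲t m))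
  (solve 5 (λ r s t C e → r :* s :+ r :* (t :+ C :* e) := r :* s :+ (r :* t :+ r :* C :* e))
    refl r (s m) (t m) C (½^ m))

≲-rearrange : ∀ {s t s′ t′} → s ≲ t → (∀ m → s′ m ℚ.+ t m ≡ s m ℚ.+ t′ m) → s′ ≲ t′
≲-rearrange {s} {t} {s′} {t′} (C , s≲t) eq = C , λ m → ≤-rearrange (s≲t m) (begin
  s′ m ℚ.+ (t m ℚ.+ C ℚ.* ½^ m)  ≡⟨ ℚ.+-assoc (s′ m) (t m) (C ℚ.* ½^ m) ⟨
  s′ m ℚ.+ t m ℚ.+ C ℚ.* ½^ m    ≡⟨ cong (ℚ._+ C ℚ.* ½^ m) (eq m) ⟩
  s m ℚ.+ t′ m ℚ.+ C ℚ.* ½^ m    ≡⟨ ℚ.+-assoc (s m) (t′ m) (C ℚ.* ½^ m) ⟩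
  s m ℚ.+ (t′ m ℚ.+ C ℚ.* ½^ m)  ∎)
  where open ≡-Reasoning

≤⇒seq-≲ : ∀ {x y} → x ≤ y → seq x ≲ seq y
≤⇒seq-≲ {x} {y} x≤y = 1ℚ ℚ.+ 1ℚ , λ m → ≤-rearrange (x≤y m)
  (solve 3 (λ x y e → x :+ (y :+ (e :+ e)) := x :+ (y :+ (con 1ℚ :+ con 1ℚ) :* e))
    refl (seq x m) (seq y m) (½^ m))

seq-≲⇒≤ : ∀ {x y} → seq x ≲ seq y → x ≤ y
seq-≲⇒≤ {x} {y} (C , x≲y) n = ≤-of-≤+½^ (C ℚ.+ (1ℚ ℚ.+ 1ℚ)) λ m →
  ≤-rearrange (ℚ.+-mono-≤ (ℚ.+-mono-≤ (regular x n m) (x≲y m)) (regular y m n))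
    (solve 7 (λ xn xm yn ym C e d →
      xn :+ (((xm :+ (d :+ e)) :+ (ym :+ C :* e)) :+ (yn :+ (e :+ d))) :=
      ((xn :+ xm) :+ ym) :+ ((yn :+ (d :+ d)) :+ (C :+ (con 1ℚ :+ con 1ℚ)) :* e))
      refl (seq x n) (seq x m) (seq y n) (seq y m) C (½^ m) (½^ n))

-- Stated for syntactic expressions, the passage from _≤_ on ℝ to _≲_ on the terms
-- involves no unification of real numbers, which would unfold regularity proofs.
data Linear : Set where
  ‵_          : ℝ → Linear
  ⊝_          : Linear → Linear
  _⊕_ _⊖_     : Linear → Linear → Linear

⟦_⟧ : Linear → ℝ
⟦ ‵ x ⟧   = x
⟦ ⊝ e ⟧   = - ⟦ e ⟧
⟦ e ⊕ f ⟧ = ⟦ e ⟧ + ⟦ f ⟧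
⟦ e ⊖ f ⟧ = ⟦ e ⟧ - ⟦ f ⟧

termwise : Linear → ℕ → ℚ
termwise (‵ x)   m = seq x m
termwise (⊝ e)   m = ℚ.- termwise e m
termwise (e ⊕ f) m = termwise e m ℚ.+ termwise f m
termwise (e ⊖ f) m = termwise e m ℚ.- termwise f m

-- Addition on ℝ reads its arguments one index later; regularity bounds the effect of this shift.
seq-suc : ∀ x → seq x ∘ suc ≈ seq x
seq-suc x =
  (½ ℚ.+ 1ℚ , λ m → ≤-rearrange (regular x (suc m) m)
    (solve 3 (λ a b e → a :+ (b :+ (con ½ :* e :+ e)) := a :+ (b :+ (con ½ :+ con 1ℚ) :* e))
      refl (seq x (suc m)) (seq x m) (½^ m))) ,
  (½ ℚ.+ 1ℚ , λ m → ≤-rearrange (regular x m (suc m))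
    (solve 3 (λ a b e → a :+ (b :+ (e :+ con ½ :* e)) := a :+ (b :+ (con ½ :+ con 1ℚ) :* e))
      refl (seq x m) (seq x (suc m)) (½^ m)))

seq-⟦⟧ : ∀ e → seq ⟦ e ⟧ ≈ termwise e
seq-⟦⟧ (‵ x)   = ≤⇒≲ (λ m → ℚ.≤-refl) , ≤⇒≲ (λ m → ℚ.≤-refl)
seq-⟦⟧ (⊝ e) with seq-⟦⟧ e
... | x≲s , s≲x = neg-antimono-≲ s≲x , neg-antimono-≲ x≲s
seq-⟦⟧ (e ⊕ f) with seq-⟦⟧ e | seq-⟦⟧ f
... | x≲s , s≲x | y≲t , t≲y =
  +-mono-≲ (≲-trans (proj₁ (seq-suc ⟦ e ⟧)) x≲s) (≲-trans (proj₁ (seq-suc ⟦ f ⟧)) y≲t) ,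
  +-mono-≲ (≲-trans s≲x (proj₂ (seq-suc ⟦ e ⟧))) (≲-trans t≲y (proj₂ (seq-suc ⟦ f ⟧)))
seq-⟦⟧ (e ⊖ f) with seq-⟦⟧ e | seq-⟦⟧ f
... | x≲s , s≲x | y≲t , t≲y =
  +-mono-≲ (≲-trans (proj₁ (seq-suc ⟦ e ⟧)) x≲s)
           (neg-antimono-≲ (≲-trans t≲y (proj₂ (seq-suc ⟦ f ⟧)))) ,
  +-mono-≲ (≲-trans s≲x (proj₂ (seq-suc ⟦ e ⟧)))
           (neg-antimono-≲ (≲-trans (proj₁ (seq-suc ⟦ f ⟧)) y≲t))

≤⇒termwise : ∀ e f → ⟦ e ⟧ ≤ ⟦ f ⟧ → termwise e ≲ termwise f
≤⇒termwise e f e≤f =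
  ≲-trans (proj₂ (seq-⟦⟧ e)) (≲-trans (≤⇒seq-≲ {⟦ e ⟧} {⟦ f ⟧} e≤f) (proj₁ (seq-⟦⟧ f)))

termwise⇒≤ : ∀ e f → termwise e ≲ termwise f → ⟦ e ⟧ ≤ ⟦ f ⟧
termwise⇒≤ e f e≲f =
  seq-≲⇒≤ {⟦ e ⟧} {⟦ f ⟧} (≲-trans (proj₁ (seq-⟦⟧ e)) (≲-trans e≲f (proj₂ (seq-⟦⟧ f))))

-- Order, halving, maxima and minima of real numbers.

≤-trans : ∀ x y z → x ≤ y → y ≤ z → x ≤ z
≤-trans x y z x≤y y≤z =
  seq-≲⇒≤ {x} {z} (≲-trans (≤⇒seq-≲ {x} {y} x≤y) (≤⇒seq-≲ {y} {z} y≤z))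

seq-≤⇒≤ : ∀ {x y} → (∀ n → seq x n ℚ.≤ seq y n) → x ≤ y
seq-≤⇒≤ {x} {y} x≤y = seq-≲⇒≤ {x} {y} (≤⇒≲ x≤y)

≤-refl : ∀ x → x ≤ x
≤-refl x = seq-≤⇒≤ {x} {x} (λ n → ℚ.≤-refl)

<⇒≤ : ∀ {x y} → x < y → x ≤ y
<⇒≤ {x} {y} (n , x<y) m = ≤-rearrange
  (ℚ.+-mono-≤ (ℚ.+-mono-≤ (regular x m n) (ℚ.<⇒≤ x<y)) (regular y n m))
  (solve 6 (λ xn xm yn ym e d →
    xm :+ (((xn :+ (e :+ d)) :+ yn) :+ (ym :+ (d :+ e))) :=
    ((xm :+ (xn :+ (d :+ d))) :+ yn) :+ (ym :+ (e :+ e)))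
    refl (seq x n) (seq x m) (seq y n) (seq y m) (½^ m) (½^ n))

-- This is constructive: at each index the rational test is decidable, and its failure is a witness
-- of `x < y`, which contradicts the hypothesis.
≰⇒≥ : ∀ {x y} → ¬ (x ≤ y) → y ≤ x
≰⇒≥ {x} {y} x≰y n with seq y n ℚ.≤? seq x n ℚ.+ ((½^ n) ℚ.+ (½^ n))
... | yes y≤x = y≤x
... | no  y≰x = contradiction (<⇒≤ {x} {y} (n , ℚ.≰⇒> y≰x)) x≰y

-- Halving the terms halves their distances, so the sequence stays regular at the same indices. It
-- serves to move the factor 2 to the other side in the comparison of infima.
½·_ : ℝ → ℝ
½· x = mkℝ (λ n → ½ ℚ.* seq x n) λ m n →
  ℚ.≤-trans (ℚ.*-monoˡ-≤-nonNeg ½ (regular x m n))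
    (≤-rearrange
      (ℚ.+-monoʳ-≤ (½ ℚ.* seq x n) (ℚ.*-monoʳ-≤-nonNeg ((½^ m) ℚ.+ (½^ n))
        {{ℚ.nonNegative (ℚ.+-mono-≤ (0≤½^ m) (0≤½^ n))}} (from-yes (½ ℚ.≤? 1ℚ))))
      (solve 3 (λ a d e →
        con ½ :* (a :+ (d :+ e)) :+ (con ½ :* a :+ con 1ℚ :* (d :+ e)) :=
        (con ½ :* a :+ con ½ :* (d :+ e)) :+ (con ½ :* a :+ (d :+ e)))
        refl (seq x n) (½^ m) (½^ n)))

x≤y+y⇒½x≤y : ∀ {x y} → x ≤ y + y → ½· x ≤ y
x≤y+y⇒½x≤y {x} {y} x≤2y = seq-≲⇒≤ {½· x} {y} (≲-rearrange
  (*-monoˡ-≲ ½ (≤⇒termwise (‵ x) (‵ y ⊕ ‵ y) x≤2y))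
  (λ m → solve 2 (λ x y → con ½ :* x :+ con ½ :* (y :+ y) := con ½ :* x :+ y)
    refl (seq x m) (seq y m)))

½x≤y⇒x≤y+y : ∀ {x y} → ½· x ≤ y → x ≤ y + y
½x≤y⇒x≤y+y {x} {y} ½x≤y = termwise⇒≤ (‵ x) (‵ y ⊕ ‵ y) (≲-rearrange
  (+-mono-≲ ½x≲y ½x≲y)
  (λ m → solve 2 (λ x y → x :+ (y :+ y) := con ½ :* x :+ con ½ :* x :+ (y :+ y))
    refl (seq x m) (seq y m)))
  where
  ½x≲y = ≤⇒seq-≲ {½· x} {y} ½x≤y

⊔-lub : ∀ {x y z} → x ≤ z → y ≤ z → x ⊔ y ≤ z
⊔-lub x≤z y≤z n = ℚ.⊔-lub (x≤z n) (y≤z n)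

⊓-glb : ∀ {x y z} → z ≤ x → z ≤ y → z ≤ x ⊓ y
⊓-glb {x} {y} z≤x z≤y n = subst (_ ℚ.≤_)
  (sym (ℚ.mono-≤-distrib-⊓ (ℚ.+-monoˡ-≤ ((½^ n) ℚ.+ (½^ n))) (seq x n) (seq y n)))
  (ℚ.⊓-glb (z≤x n) (z≤y n))

max-lub : ∀ {n} .{{_ : NonZero n}} {f : Fin n → ℝ} {z} → (∀ i → f i ≤ z) → max f ≤ z
max-lub {zero}            f≤z = contradiction refl (≢-nonZero⁻¹ 0)
max-lub {suc zero}        f≤z = f≤z zero
max-lub {suc (suc n)} {f} {z} f≤z =
  ⊔-lub {f zero} {max (f ∘ suc)} {z} (f≤z zero) (max-lub {suc n} {f ∘ suc} {z} (f≤z ∘ suc))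

min-glb : ∀ {n} .{{_ : NonZero n}} {f : Fin n → ℝ} {z} → (∀ i → z ≤ f i) → z ≤ min f
min-glb {zero}            z≤f = contradiction refl (≢-nonZero⁻¹ 0)
min-glb {suc zero}        z≤f = z≤f zero
min-glb {suc (suc n)} {f} {z} z≤f =
  ⊓-glb {f zero} {min (f ∘ suc)} {z} (z≤f zero) (min-glb {suc n} {f ∘ suc} {z} (z≤f ∘ suc))

f≤max : ∀ {n} (f : Fin n → ℝ) i → f i ≤ max f
f≤max f i = seq-≤⇒≤ {f i} {max f} (seq-f≤max f i)
  where
  seq-f≤max : ∀ {n} (f : Fin n → ℝ) i m → seq (f i) m ℚ.≤ seq (max f) m
  seq-f≤max {suc zero}    f zero    m = ℚ.≤-refl
  seq-f≤max {suc (suc n)} f zero    m = ℚ.p≤p⊔q (seq (f zero) m) _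
  seq-f≤max {suc (suc n)} f (suc i) m =
    ℚ.≤-trans (seq-f≤max (f ∘ suc) i m) (ℚ.p≤q⊔p (seq (f zero) m) _)

spread-≤ : ∀ {n} .{{_ : NonZero n}} {f : Fin n → ℝ} {x} →
           (∀ i → f i ≤ x) → (∀ i → - x ≤ f i) → spread f ≤ x + x
spread-≤ {n} {f} {x} f≤x -x≤f =
  termwise⇒≤ (‵ max f ⊖ ‵ min f) (‵ x ⊕ ‵ x) (≲-rearrange
    (+-mono-≲ (≤⇒termwise (‵ max f) (‵ x) (max-lub {f = f} {x} f≤x))
              (≤⇒termwise (⊝ ‵ x) (‵ min f) (min-glb {f = f} { - x} -x≤f)))
    (λ m → solve 3 (λ M l x → (M :- l) :+ (x :+ l) := (M :+ :- x) :+ (x :+ x))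
      refl (seq (max f) m) (seq (min f) m) (seq x m)))

-- The layered graph built from a family of comparisons.

¼ 3ℚ : ℚ
¼  = ½ ℚ.* ½
3ℚ = 1ℚ ℚ.+ 1ℚ ℚ.+ 1ℚ

bounded-below : ∀ {n} (f : Fin n → ℚ) → ∃[ B ] (∀ i → B ℚ.≤ f i)
bounded-below {zero}  f = 0ℚ , λ ()
bounded-below {suc n} f with bounded-below (f ∘ suc)
... | B , B≤ = f zero ℚ.⊓ B , λ where
  zero    → ℚ.p⊓q≤p (f zero) B
  (suc i) → ℚ.≤-trans (ℚ.p⊓q≤q (f zero) B) (B≤ i)

-- Here `g` and `h` are the weights of the two edges into a vertex of V₃. Each occurs once on either
-- side of the summed inequalities and cancels. The summands `0ℝ` are the weights of the empty paths
-- in which `weight` ends.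
gap⇒difference : ∀ p q p′ q′ g h →
  p + (g + 0ℝ) + 1ℝ ≤ q + (h + 0ℝ) → q′ + (h + 0ℝ) ≤ p′ + (g + 0ℝ) →
  (p - q) + 1ℝ ≤ p′ - q′
gap⇒difference p q p′ q′ g h gap ≤′ =
  termwise⇒≤ (‵ p ⊖ ‵ q ⊕ ‵ 1ℝ) (‵ p′ ⊖ ‵ q′) (≲-rearrange
    (+-mono-≲ (≤⇒termwise (via p g ⊕ ‵ 1ℝ) (via q h) gap) (≤⇒termwise (via q′ h) (via p′ g) ≤′))
    (λ m → solve 6 (λ p q p′ q′ g h →
      (p :- q :+ con 1ℚ) :+ ((q :+ (h :+ con 0ℚ)) :+ (p′ :+ (g :+ con 0ℚ))) :=
      ((p :+ (g :+ con 0ℚ) :+ con 1ℚ) :+ (q′ :+ (h :+ con 0ℚ))) :+ (p′ :- q′))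
      refl (seq p m) (seq q m) (seq p′ m) (seq q′ m) (seq g m) (seq h m)))
  where
  via : ℝ → ℝ → Linear
  via x y = ‵ x ⊕ (‵ y ⊕ ‵ 0ℝ)

-- The data of one edge of some Gᵢ, in a form common to the three graphs; `difference` is a rational
-- approximation of hᵢ. An increase of ½ instead of 1 leaves room for rounding, and it is split into
-- ¼ for each of the two endpoints.
record Comparison (n l : ℕ) (Φ : Fin n → Fin l → ℚ) : Set where
  field
    lo hi : Fin n
    mid   : Fin 2 → Fin l
    mid-distinct : mid zero ≢ mid (suc zero)

  difference : Fin n → ℚ
  difference v = Φ v (mid zero) ℚ.- Φ v (mid (suc zero))

  field
    increases : difference lo ℚ.+ ½ ℚ.≤ difference hi

module Gadget {n l M : ℕ} (Φ : Fin n → Fin l → ℚ) (comparison : Fin M → Comparison n l Φ) where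

  open module Cmp k = Comparison (comparison k)

  Vertex : Set
  Vertex = LayeredVertex n l M

  -- Every vertex of V₁ is joined to every vertex of V₂, and each vertex of V₃ has two incoming
  -- edges. `Digraph` numbers its edges by `Fin`, so case distinctions are made on codes and
  -- transported along `code`.
  EdgeCode : Set
  EdgeCode = (Fin n × Fin l) ⊎ (Fin M × Fin 2)

  code : Fin (n *ℕ l +ℕ M *ℕ 2) ↔ EdgeCode
  code = ↔-trans +↔⊎ (*↔× ⊎-↔ *↔×)

  open Inverse code

  ends : EdgeCode → Vertex × Vertex
  ends (inj₁ (v , x)) = inj₁ v , inj₂ (inj₁ x)
  ends (inj₂ (k , s)) = inj₂ (inj₁ (mid k s)) , inj₂ (inj₂ k)

  mid-injective : ∀ k {s t} → mid k s ≡ mid k t → s ≡ t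
  mid-injective k {zero}     {zero}     eq = refl
  mid-injective k {zero}     {suc zero} eq = contradiction eq (mid-distinct k)
  mid-injective k {suc zero} {zero}     eq = contradiction (sym eq) (mid-distinct k)
  mid-injective k {suc zero} {suc zero} eq = refl

  ends-injective : ∀ c d → ends c ≡ ends d → c ≡ d
  ends-injective (inj₁ (v , x)) (inj₁ (.v , .x)) refl = refl
  ends-injective (inj₁ _)       (inj₂ _)         ()
  ends-injective (inj₂ _)       (inj₁ _)         ()
  ends-injective (inj₂ (k , s)) (inj₂ (k′ , t))  eq with cong proj₂ eq
  ... | refl with mid-injective k {s} {t} (mid-≡ (cong proj₁ eq))
    where
    mid-≡ : ∀ {x y : Fin l} → _≡_ {A = Vertex} (inj₂ (inj₁ x)) (inj₂ (inj₁ y)) → x ≡ y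
    mid-≡ refl = refl
  ... | refl = refl

  G : Digraph Vertex
  G = record
    { ∣E∣      = n *ℕ l +ℕ M *ℕ 2
    ; edge     = ends ∘ to
    ; edge-inj = λ {e} {f} eq → Injection.injective (Inverse⇒Injection code) (ends-injective (to e) (to f) eq)
    }

  ends-consecutive : ∀ c → Consecutive (ends c)
  ends-consecutive (inj₁ (v , x)) = V₁→V₂ v x
  ends-consecutive (inj₂ (k , s)) = V₂→V₃ (mid k s) k

  edge-from : ∀ c → edge G (from c) ≡ ends c
  edge-from c = cong ends (strictlyInverseˡ c)

  route : ∀ v k → Fin 2 → Path G (inj₁ v) (inj₂ (inj₂ k))
  route v k s = step (from (inj₁ (v , mid k s))) (edge-from (inj₁ (v , mid k s)))
    (step (from (inj₂ (k , s))) (edge-from (inj₂ (k , s))) [])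

  -- Equality of the terms, since _≡_ on ℝ also compares the regularity proofs.
  path-route : ∀ {v k} (π : Path G (inj₁ v) (inj₂ (inj₂ k))) →
               ∃[ s ] (∀ w m → seq (weight G w π) m ≡ seq (weight G w (route v k s)) m)
  -- The helpers take the code of an edge as a variable tied to the edge by `from c ≡ f`, so that
  -- matching on the code reduces `ends` and the endpoint equations can be matched with `refl`.
  path-route {v} {k} (step e p π) = first (to e) (strictlyInverseʳ e) p π
    where
    last : ∀ c {f x y} → from c ≡ f → ends c ≡ (inj₂ (inj₁ x) , y) → (π : Path G y (inj₂ (inj₂ k))) →
           ∃[ s ] (x ≡ mid k s ×
                   (∀ w m → seq (w f + weight G w π) m ≡ seq (w (from (inj₂ (k , s))) + 0ℝ) m))
    last (inj₂ (_ , s)) refl refl []           = s , refl , λ w m → refl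
    last (inj₂ (k′ , s)) refl refl (step g r π) = contradiction r (no-exit (to g))
      where
      no-exit : ∀ c {y} → ends c ≢ (inj₂ (inj₂ k′) , y)
      no-exit (inj₁ _) ()
      no-exit (inj₂ _) ()

    second : ∀ {x} (π : Path G (inj₂ (inj₁ x)) (inj₂ (inj₂ k))) →
             ∃[ s ] (x ≡ mid k s ×
                     (∀ w m → seq (weight G w π) m ≡ seq (w (from (inj₂ (k , s))) + 0ℝ) m))
    second (step f q π) = last (to f) (strictlyInverseʳ f) q π

    first : ∀ c {e y} → from c ≡ e → ends c ≡ (inj₁ v , y) → (π : Path G y (inj₂ (inj₂ k))) →
            ∃[ s ] (∀ w m → seq (w e + weight G w π) m ≡ seq (weight G w (route v k s)) m)
    first (inj₁ (_ , x)) refl refl π with second π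
    ... | s , refl , eq = s , λ w m →
      cong (seq (w (from (inj₁ (v , mid k s)))) (suc m) ℚ.+_) (eq w (suc m))

  -- The second route to k costs ¼ more than the first one from lo k, and at least
  -- ½ - ¼ less from hi k.
  cost : EdgeCode → ℚ
  cost (inj₁ (v , x))            = Φ v x
  cost (inj₂ (k , zero))         = 0ℚ
  cost (inj₂ (k , suc zero))     = difference k (lo k) ℚ.+ ¼

  minimum : ∃[ B ] (∀ e → B ℚ.≤ cost (to e))
  minimum = bounded-below (cost ∘ to)

  -- Every path from V₁ to V₃ has two edges, so a common offset is harmless.
  offset : ℚ
  offset = 3ℚ ℚ.- proj₁ minimum

  wt : Weighting G
  wt e = fromℚ (cost (to e) ℚ.+ offset)

  wt-positive : Positive G wt
  -- Positivity witnessed at index 0 asks for a term above `½^ 0 + ½^ 0 = 2`. The offset makes every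
  -- weight at least 3.
  wt-positive e = 0 , ℚ.<-≤-trans 2<3 (≤-rearrange (proj₂ minimum e)
    (solve 3 (λ t c B → t :+ c := B :+ (c :+ (t :- B))) refl 3ℚ (cost (to e)) (proj₁ minimum)))
    where
    2<3 : 0ℚ ℚ.+ ((½^ 0) ℚ.+ (½^ 0)) ℚ.< 3ℚ
    2<3 = from-yes (0ℚ ℚ.+ ((½^ 0) ℚ.+ (½^ 0)) ℚ.<? 3ℚ)

  routeCost : Fin n → Fin M → Fin 2 → ℚ
  routeCost v k s = cost (inj₁ (v , mid k s)) ℚ.+ cost (inj₂ (k , s))

  weight-route : ∀ v k s m → seq (weight G wt (route v k s)) m ≡ routeCost v k s ℚ.+ (offset ℚ.+ offset)
  weight-route v k s m
    rewrite strictlyInverseˡ (inj₁ (v , mid k s)) | strictlyInverseˡ (inj₂ (k , s)) =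
    solve 3 (λ a b o → (a :+ o) :+ ((b :+ o) :+ con 0ℚ) := (a :+ b) :+ (o :+ o)) refl
      (cost (inj₁ (v , mid k s))) (cost (inj₂ (k , s))) offset

  dearer⇒¬shortest : ∀ v k s t → routeCost v k s ℚ.+ ¼ ℚ.≤ routeCost v k t →
                     ¬ IsShortest G wt (route v k t)
  -- At index 4 the tolerance in `_≤_` is 1/8, which is less than the difference ¼ between the
  -- routes.
  dearer⇒¬shortest v k s t dearer t-shortest = from-no (¼ ℚ.≤? ((½^ 4) ℚ.+ (½^ 4)))
    (≤-rearrange (ℚ.+-mono-≤ dearer t≤s)
      (solve 5 (λ a b o q e →
        q :+ (b :+ ((a :+ o) :+ e)) := ((a :+ q) :+ (b :+ o)) :+ e) refl
        (routeCost v k s) (routeCost v k t) (offset ℚ.+ offset) ¼ ((½^ 4) ℚ.+ (½^ 4))))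
    where
    t≤s : routeCost v k t ℚ.+ (offset ℚ.+ offset) ℚ.≤
          routeCost v k s ℚ.+ (offset ℚ.+ offset) ℚ.+ ((½^ 4) ℚ.+ (½^ 4))
    t≤s = subst₂ (λ a b → a ℚ.≤ b ℚ.+ ((½^ 4) ℚ.+ (½^ 4)))
      (weight-route v k t 4) (weight-route v k s 4) (t-shortest (route v k s) 4)

  dag : WeightedLayeredDAG
  dag = record
    { ∣V₁∣ = n ; ∣V₂∣ = l ; ∣V₃∣ = M
    ; graph      = G
    ; layered    = ends-consecutive ∘ to
    ; w          = wt
    ; w-positive = wt-positive
    }

  potential : Weighting G → Fin n → Fin l → ℝ
  potential w v x = w (from (inj₁ (v , x)))

  module _ (w′ : Weighting G) (preserver : IsGap1Preserver G wt w′) where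

    open IsGap1Preserver preserver

    -- By `preserve`, the route through `t` is not shortest for `w′`. By `path-route` only two
    -- weights compete, so `W t ≤ W s` would make that route shortest; hence `W s ≤ W t`, the route
    -- through `s` is shortest, and `gap` applies to the pair.
    cheaper⇒gap : ∀ v k s t → (∀ r → r ≡ s ⊎ r ≡ t) →
      routeCost v k s ℚ.+ ¼ ℚ.≤ routeCost v k t →
      IsShortest G w′ (route v k s) ×
      weight G w′ (route v k s) + 1ℝ ≤ weight G w′ (route v k t)
    cheaper⇒gap v k s t s⊎t cheaper = s-shortest , gap (route v k s) (route v k t) s-shortest ¬t-shortest
      where
      W : Fin 2 → ℝ
      W r = weight G w′ (route v k r)

      ¬t-shortest : ¬ IsShortest G w′ (route v k t)
      ¬t-shortest = dearer⇒¬shortest v k s t cheaper ∘ preserve (route v k t)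

      least⇒shortest : ∀ r → (∀ r′ → W r ≤ W r′) → IsShortest G w′ (route v k r)
      least⇒shortest r least π m with path-route π
      ... | r′ , eq = subst (λ q → seq (W r) m ℚ.≤ q ℚ.+ ((½^ m) ℚ.+ (½^ m))) (sym (eq w′ m)) (least r′ m)

      s≤t : W s ≤ W t
      s≤t = ≰⇒≥ {W t} {W s} λ t≤s → ¬t-shortest (least⇒shortest t λ r′ → case-t t≤s (s⊎t r′))
        where
        case-t : W t ≤ W s → ∀ {r} → r ≡ s ⊎ r ≡ t → W t ≤ W r
        case-t t≤s (inj₁ refl) = t≤s
        case-t t≤s (inj₂ refl) = ≤-refl (W t)

      s-shortest : IsShortest G w′ (route v k s)
      s-shortest = least⇒shortest s λ r′ → case-s (s⊎t r′)
        where
        case-s : ∀ {r} → r ≡ s ⊎ r ≡ t → W s ≤ W r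
        case-s (inj₁ refl) = ≤-refl (W s)
        case-s (inj₂ refl) = s≤t

    private
      φ : Fin n → Fin l → ℝ
      φ = potential w′

    -- At `lo k` the gap between the two routes is used, at `hi k` only that the second route is
    -- shortest. In the sum the weights of the edges into `k` cancel and one full unit remains.
    potential-difference : ∀ k →
      (φ (lo k) (mid k zero) - φ (lo k) (mid k (suc zero))) + 1ℝ ≤
      φ (hi k) (mid k zero) - φ (hi k) (mid k (suc zero))
    potential-difference k = gap⇒difference
      (φ (lo k) (mid k zero)) (φ (lo k) (mid k (suc zero)))
      (φ (hi k) (mid k zero)) (φ (hi k) (mid k (suc zero)))
      (w′ (from (inj₂ (k , zero)))) (w′ (from (inj₂ (k , suc zero))))
      (proj₂ (cheaper⇒gap (lo k) k zero (suc zero)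
        (λ { zero → inj₁ refl ; (suc zero) → inj₂ refl }) cheaper-lo))
      (proj₁ (cheaper⇒gap (hi k) k (suc zero) zero
        (λ { zero → inj₂ refl ; (suc zero) → inj₁ refl }) cheaper-hi)
        (route (hi k) k zero))
      where
      cheaper-lo : routeCost (lo k) k zero ℚ.+ ¼ ℚ.≤ routeCost (lo k) k (suc zero)
      cheaper-lo = ℚ.≤-reflexive
        (solve 3 (λ a b q → (a :+ con 0ℚ) :+ q := b :+ (a :- b :+ q)) refl
          (Φ (lo k) (mid k zero)) (Φ (lo k) (mid k (suc zero))) ¼)

      -- The second edge into `k` costs `difference k (lo k) + ¼`, and the difference at `hi k`
      -- exceeds the one at `lo k` by at least ½, so ¼ is left.
      cheaper-hi : routeCost (hi k) k (suc zero) ℚ.+ ¼ ℚ.≤ routeCost (hi k) k zero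
      cheaper-hi = ≤-rearrange (increases k)
        (solve 3 (λ d a b →
          (b :+ (d :+ con ¼) :+ con ¼) :+ (a :- b) := (d :+ con ½) :+ (a :+ con 0ℚ)) refl
          (difference k (lo k)) (Φ (hi k) (mid k zero)) (Φ (hi k) (mid k (suc zero))))

-- Infima, spreads and rational approximation.

-- The clause on lower bounds implies the one on infima: `a` is a lower bound of `P`, so `½· a` is a
-- lower bound of `Q` and lies below `b`.
doubled-infimum : ∀ {P Q} → (∀ ℓ → IsLowerBound P ℓ → ∀ r → Q r → ℓ ≤ r + r) → Inf P ≤2·Inf Q
doubled-infimum bound =
  (λ a b a-inf b-inf → ½x≤y⇒x≤y+y {a} {b} (proj₂ b-inf (½· a) λ r Qr →
    x≤y+y⇒½x≤y {a} {r} (bound a (proj₁ a-inf) r Qr))) ,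
  bound

double-mono : ∀ {x y} → x ≤ y → x + x ≤ y + y
double-mono {x} {y} x≤y =
  termwise⇒≤ (‵ x ⊕ ‵ x) (‵ y ⊕ ‵ y) (+-mono-≲ x≲y x≲y)
  where
  x≲y = ≤⇒seq-≲ {x} {y} x≤y

telescope : ∀ x y z → (x - y) + (y - z) ≃ x - z
telescope x y z =
  termwise⇒≤ (‵ x ⊖ ‵ y ⊕ (‵ y ⊖ ‵ z)) (‵ x ⊖ ‵ z) (≤⇒≲ (ℚ.≤-reflexive ∘ eq)) ,
  termwise⇒≤ (‵ x ⊖ ‵ z) (‵ x ⊖ ‵ y ⊕ (‵ y ⊖ ‵ z)) (≤⇒≲ (ℚ.≤-reflexive ∘ sym ∘ eq))
  where
  eq : ∀ m → (seq x m ℚ.- seq y m) ℚ.+ (seq y m ℚ.- seq z m) ≡ seq x m ℚ.- seq z m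
  eq m = solve 3 (λ x y z → (x :- y) :+ (y :- z) := x :- z) refl (seq x m) (seq y m) (seq z m)

difference-spread : ∀ {n} .{{_ : NonZero n}} (f g : Fin n → ℝ) M →
  (∀ v → 0ℝ ≤ f v) → (∀ v → f v ≤ M) → (∀ v → 0ℝ ≤ g v) → (∀ v → g v ≤ M) →
  spread (λ v → f v - g v) ≤ M + M
difference-spread f g M 0≤f f≤M 0≤g g≤M = spread-≤ {f = λ v → f v - g v} {M}
  (λ v → termwise⇒≤ (‵ f v ⊖ ‵ g v) (‵ M) (≲-rearrange
    (+-mono-≲ (≤⇒seq-≲ {f v} {M} (f≤M v)) (≤⇒seq-≲ {0ℝ} {g v} (0≤g v)))
    (λ m → solve 3 (λ f g M → (f :- g) :+ (M :+ g) := (f :+ con 0ℚ) :+ M)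
      refl (seq (f v) m) (seq (g v) m) (seq M m))))
  (λ v → termwise⇒≤ (⊝ ‵ M) (‵ f v ⊖ ‵ g v) (≲-rearrange
    (+-mono-≲ (≤⇒seq-≲ {g v} {M} (g≤M v)) (≤⇒seq-≲ {0ℝ} {f v} (0≤f v)))
    (λ m → solve 3 (λ f g M → :- M :+ (M :+ f) := (g :+ con 0ℚ) :+ (f :- g))
      refl (seq (f v) m) (seq (g v) m) (seq M m))))

½^5 : ℚ
½^5 = ½^ 5

-- The hypothesis at index 5 reads `x` at index 6, because of the shift in addition, and regularity
-- moves `y` from 5 to 6. The total error is 7/64, so ½ of the unit survives.
approx-increases : ∀ x y → x + 1ℝ ≤ y → seq x 6 ℚ.+ ½ ℚ.≤ seq y 6
approx-increases x y x+1≤y = ≤-rearrange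
  (ℚ.+-mono-≤ (ℚ.+-mono-≤ (x+1≤y 5) (regular y 5 6))
    (from-yes ((½^5 ℚ.+ ½^5) ℚ.+ (½^5 ℚ.+ ½ ℚ.* ½^5) ℚ.+ ½ ℚ.≤? 1ℚ)))
  (solve 4 (λ x y y′ e →
    (x :+ con ½) :+ (((y′ :+ (e :+ e)) :+ (y :+ (e :+ con ½ :* e))) :+ con 1ℚ) :=
    (((x :+ con 1ℚ) :+ y′) :+ ((e :+ e) :+ (e :+ con ½ :* e) :+ con ½)) :+ y)
    refl (seq x 6) (seq y 6) (seq y 5) ½^5)

-- The increase is known for `z`, while the potentials contain only the terms of `x` and `y`.
-- Passing from `x + y` to `z` and from `z′` to `x′ + y′` adds further errors, 15/64 in total, still
-- at most ½.
approx-sum-increases : ∀ x y z x′ y′ z′ → x + y ≤ z → z + 1ℝ ≤ z′ → z′ ≤ x′ + y′ →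
  (seq x 6 ℚ.+ seq y 6) ℚ.+ ½ ℚ.≤ seq x′ 6 ℚ.+ seq y′ 6
approx-sum-increases x y z x′ y′ z′ x+y≤z z+1≤z′ z′≤x′+y′ = ≤-rearrange
  (ℚ.+-mono-≤ (ℚ.+-mono-≤ (ℚ.+-mono-≤ (x+y≤z 5) (regular z 5 6)) (ℚ.+-mono-≤ (z+1≤z′ 5) (z′≤x′+y′ 5)))
    (from-yes (((½^5 ℚ.+ ½^5) ℚ.+ (½^5 ℚ.+ ½ ℚ.* ½^5)) ℚ.+ ((½^5 ℚ.+ ½^5) ℚ.+ (½^5 ℚ.+ ½^5)) ℚ.+ ½ ℚ.≤? 1ℚ)))
  (solve 6 (λ s z z₅ t z′ e →
    (s :+ con ½) :+ ((((z₅ :+ (e :+ e)) :+ (z :+ (e :+ con ½ :* e))) :+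
                      ((z′ :+ (e :+ e)) :+ (t :+ (e :+ e)))) :+ con 1ℚ) :=
    (((s :+ z₅) :+ ((z :+ con 1ℚ) :+ z′)) :+
      (((e :+ e) :+ (e :+ con ½ :* e)) :+ ((e :+ e) :+ (e :+ e)) :+ con ½)) :+ t)
    refl (seq x 6 ℚ.+ seq y 6) (seq z 6) (seq z 5) (seq x′ 6 ℚ.+ seq y′ 6) (seq z′ 5) ½^5)

-- The gadget of an additive triple and the order preservers read off from it.

module Reduction {n : ℕ} (G₁ G₂ G₃ : Digraph (Fin n)) (h₁ h₂ h₃ : Fin n → ℝ)
                 (ordered : IsOrderPreserver G₁ G₂ G₃ h₁ h₂ h₃) where

  ordered₁ = proj₁ ordered
  ordered₂ = proj₁ (proj₂ ordered)
  ordered₃ = proj₁ (proj₂ (proj₂ ordered))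
  additive = proj₂ (proj₂ (proj₂ ordered))

  pattern p = zero
  pattern q = suc zero
  pattern r = suc (suc zero)

  -- Rational potentials suffice for the weights, since the terms at index 6 are
  -- precise enough to retain half of each unit increase.
  Φ : Fin n → Fin 3 → ℚ
  Φ v p = seq (h₁ v) 6
  Φ v q = 0ℚ
  Φ v r = ℚ.- seq (h₂ v) 6

  TripleEdge : Set
  TripleEdge = (Edge G₁ ⊎ Edge G₂) ⊎ Edge G₃

  tripleEdge : Fin (∣E∣ G₁ +ℕ ∣E∣ G₂ +ℕ ∣E∣ G₃) ↔ TripleEdge
  tripleEdge = ↔-trans +↔⊎ (+↔⊎ ⊎-↔ ↔-refl)

  pair : Fin 3 → Fin 3 → Fin 2 → Fin 3
  pair x y zero       = x
  pair x y (suc zero) = y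

  comparison : TripleEdge → Comparison n 3 Φ
  comparison (inj₁ (inj₁ e)) = record
    { lo = src G₁ e ; hi = tgt G₁ e ; mid = pair p q ; mid-distinct = λ ()
    ; increases = ≤-rearrange (approx-increases (h₁ (src G₁ e)) (h₁ (tgt G₁ e)) (ordered₁ e))
        (solve 2 (λ x y → ((x :- con 0ℚ) :+ con ½) :+ y := (x :+ con ½) :+ (y :- con 0ℚ))
          refl (seq (h₁ (src G₁ e)) 6) (seq (h₁ (tgt G₁ e)) 6))
    }
  comparison (inj₁ (inj₂ e)) = record
    { lo = src G₂ e ; hi = tgt G₂ e ; mid = pair q r ; mid-distinct = λ ()
    ; increases = ≤-rearrange (approx-increases (h₂ (src G₂ e)) (h₂ (tgt G₂ e)) (ordered₂ e))
        (solve 2 (λ x y → ((con 0ℚ :- :- x) :+ con ½) :+ y := (x :+ con ½) :+ (con 0ℚ :- :- y))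
          refl (seq (h₂ (src G₂ e)) 6) (seq (h₂ (tgt G₂ e)) 6))
    }
  comparison (inj₂ e) = record
    { lo = u ; hi = v ; mid = pair p r ; mid-distinct = λ ()
    ; increases = ≤-rearrange
        (approx-sum-increases (h₁ u) (h₂ u) (h₃ u) (h₁ v) (h₂ v) (h₃ v)
          (proj₁ (additive u)) (ordered₃ e) (proj₂ (additive v)))
        (solve 4 (λ x y x′ y′ → ((x :- :- y) :+ con ½) :+ (x′ :+ y′) :=
                                ((x :+ y) :+ con ½) :+ (x′ :- :- y′))
          refl (seq (h₁ u) 6) (seq (h₂ u) 6) (seq (h₁ v) 6) (seq (h₂ v) 6))
    }
    where
    u = src G₃ e
    v = tgt G₃ e

  open Inverse tripleEdge using (to; from; strictlyInverseˡ)
  open Gadget Φ (comparison ∘ to) public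

  module _ (w′ : Weighting G) (preserver : IsGap1Preserver G wt w′) where

    h : Fin 3 → Fin 3 → Fin n → ℝ
    h x y v = potential w′ v x - potential w′ v y

    h-increases : ∀ e → let open Comparison (comparison e) in
      h (mid zero) (mid (suc zero)) lo + 1ℝ ≤ h (mid zero) (mid (suc zero)) hi
    h-increases e = subst
      (λ e → let open Comparison (comparison e) in
        h (mid zero) (mid (suc zero)) lo + 1ℝ ≤ h (mid zero) (mid (suc zero)) hi)
      (strictlyInverseˡ e) (potential-difference w′ preserver (from e))

    h-ordered : IsOrderPreserver G₁ G₂ G₃ (h p q) (h q r) (h p r)
    h-ordered =
      (h-increases ∘ inj₁ ∘ inj₁) , (h-increases ∘ inj₁ ∘ inj₂) , (h-increases ∘ inj₂) ,
      λ v → telescope (potential w′ v p) (potential w′ v q) (potential w′ v r)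

    h-range : .{{_ : NonZero n}} → range (h p q) (h q r) (h p r) ≤ max w′ + max w′
    h-range = ⊔-lub {spread (h p q) ⊔ spread (h q r)} {spread (h p r)} {M + M}
      (⊔-lub {spread (h p q)} {spread (h q r)} {M + M} (h-spread p q) (h-spread q r))
      (h-spread p r)
      where
      M : ℝ
      M = max w′

      0≤w′ : ∀ e → 0ℝ ≤ w′ e
      0≤w′ e = <⇒≤ {0ℝ} {w′ e} (IsGap1Preserver.positive preserver e)

      h-spread : ∀ x y → spread (h x y) ≤ M + M
      h-spread x y = difference-spread (λ v → potential w′ v x) (λ v → potential w′ v y) M
        (λ v → 0≤w′ _) (λ v → f≤max w′ _) (λ v → 0≤w′ _) (λ v → f≤max w′ _)

theorem1p12 : ∀ {n : ℕ} → .{{_ : NonZero n}} →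
    (G₁ G₂ G₃ : Digraph (Fin n)) →
    Acyclic G₁ → Acyclic G₂ → Acyclic G₃ →
    IsAdditiveTriple G₁ G₂ G₃ →
    ∃[ G* ] (∣V₂∣ G* ≡ 3 ×
    ∣V₁∣ G* ≡ n ×
    ∣V₃∣ G* ≡ ∣E∣ G₁ +ℕ ∣E∣ G₂ +ℕ ∣E∣ G₃ ×
    (Inf PreserverRange G₁ G₂ G₃ ≤2·Inf PreserverMaxWeight (graph G*) (w G*)))
theorem1p12 G₁ G₂ G₃ _ _ _ (h₁ , h₂ , h₃ , ordered) =
  dag , refl , refl , refl , doubled-infimum λ where
    ℓ ℓ-lower b (w′ , preserver , _ , max≤b) →
      -- `R` is the range of an order preserver, so `ℓ ≤ R`, and `R` is at most twice the maximum of
      -- `w′`. The value `b` is only `≃` to that maximum, hence the final passage through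
      -- `double-mono`.
      let R = range (h w′ preserver p q) (h w′ preserver q r) (h w′ preserver p r)
      in ≤-trans ℓ R (b + b)
           (ℓ-lower R (_ , _ , _ , h-ordered w′ preserver , ≤-refl R , ≤-refl R))
           (≤-trans R (max w′ + max w′) (b + b) (h-range w′ preserver)
             (double-mono {max w′} {b} max≤b))
  where
  open Reduction G₁ G₂ G₃ h₁ h₂ h₃ ordered
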